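{- Let $t \ge 1$ be an integer. For any integer $s$ with $0 < s < 2^t$, there exists no $t$-$(v,t+1)$ Latin trade of volume $s$ (for any positive integer $v$).
   Context: Let $t \le k$ and $v$ be positive integers, $V = \{1,\dots,v\}$, and let $V^k$ be the set of ordered $k$-tuples of elements of $V$. For a $t$-subset $I = \{i_1 < \cdots < i_t\}$ of $\{1,\dots,k\}$ and $(u_1,\dots,u_t) \in V^t$, the tuple $(x_1,\dots,x_k) \in V^k$ is said to contain $(u_1,\dots,u_t)_I$ if $x_{i_j} = u_j$ for all $j = 1,\dots,t$. A $t$-$(v,k)$ Latin trade of volume $s$ is a pair $T = (T_1,T_2)$ of disjoint collections (finite multisets, i.e. repeated elements are allowed; disjoint means no tuple occurs in both), each consisting of $s$ elements of $V^k$ counted with multiplicity, such that for each $t$-subset $I \subseteq \{1,\dots,k\}$ and each $(u_1,\dots,u_t) \in V^t$, the number of elements (with multiplicity) of $T_1$ containing $(u_1,\dots,u_t)_I$ equals the number of elements of $T_2$ containing $(u_1,\dots,u_t)_I$. -}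

module Defs where

open import Data.Fin using (Fin; _<_; _≟_)
open import Data.Fin.Properties using (all?)
open import Data.List using (List; length; filter)
open import Data.List.Relation.Binary.Disjoint.Propositional using (Disjoint)
open import Data.Nat using (ℕ)
open import Data.Vec using (Vec; lookup)
open import Relation.Binary.Core using (_Preserves_⟶_)
open import Relation.Binary.PropositionalEquality using (_≡_)
open import Relation.Nullary using (Dec)

-- V = {1,…,v} is represented by Fin v, and V^k by vectors.
Tuple : ℕ → ℕ → Set
Tuple v k = Vec (Fin v) k

-- A t-subset {i₁ < ⋯ < iₜ} of {1,…,k}, given by its increasing enumeration.
record Subset (t k : ℕ) : Set where
  field
    index      : Fin t → Fin k
    increasing : index Preserves _<_ ⟶ _<_

open Subset public

Contains : ∀ {t v k} → Subset t k → Tuple v t → Tuple v k → Set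
Contains I u x = ∀ j → lookup x (index I j) ≡ lookup u j

contains? : ∀ {t v k} (I : Subset t k) (u : Tuple v t) (x : Tuple v k) →
            Dec (Contains I u x)
contains? I u x = all? (λ j → lookup x (index I j) ≟ lookup u j)

-- Finite multisets of tuples are represented by lists; everything below is
-- invariant under permuting the list, and counts multiplicity.
count : ∀ {t v k} → Subset t k → Tuple v t → List (Tuple v k) → ℕ
count I u T = length (filter (contains? I u) T)

record LatinTrade (t v k s : ℕ) : Set where
  field
    T₁ T₂    : List (Tuple v k)
    disjoint : Disjoint T₁ T₂
    volume₁  : length T₁ ≡ s
    volume₂  : length T₂ ≡ s
    balanced : (I : Subset t k) (u : Tuple v t) → count I u T₁ ≡ count I u T₂

{-# OPTIONS --safe #-}
module Submission where

-- Slice a trade by its first coordinate. Every slice is again balanced, one dimension lower.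
-- If x ∈ T₁ has head a, balance on the remaining coordinates gives y ∈ T₂ with the same tail
-- as x; by disjointness its head b differs from a, and balance on a set containing the first
-- coordinate brings b back as the head of some z ∈ T₁. So T₁ has two nonempty slices, and
-- its size at least doubles with each dimension.

open import Defs
open import Data.Bool using (true; false)
open import Data.Fin using (Fin; zero; suc; _≟_)
open import Data.List using (List; []; _∷_; length; map; filter)
open import Data.List.Membership.Propositional using (_∈_)
open import Data.List.Membership.Propositional.Properties
  using (∈-map⁺; ∈-map⁻; ∈-filter⁺; ∈-filter⁻; ∈-length)
open import Data.List.Relation.Binary.Disjoint.Propositional using (Disjoint)
open import Data.List.Relation.Unary.Any using (here)
open import Data.Nat using (ℕ; zero; suc; _+_; _^_; _≤_; _<_; z≤n; s≤s)
open import Data.Nat.Properties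
  using (+-comm; +-identityʳ; +-mono-≤; +-suc; m≤n⇒m≤1+n; <⇒≱; module ≤-Reasoning)
open import Data.Product using (∃; _×_; _,_; proj₁; proj₂)
open import Data.Vec using (_∷_; head; tail; lookup; tabulate)
open import Data.Vec.Properties using (lookup∘tabulate; tabulate∘lookup; tabulate-cong)
open import Relation.Binary.PropositionalEquality
  using (_≡_; _≢_; refl; sym; trans; cong; subst; module ≡-Reasoning)
open import Relation.Nullary using (¬_; yes; no; does; contradiction)

private
  variable
    t v k : ℕ

Balanced : ∀ t → List (Tuple v k) → List (Tuple v k) → Set
Balanced {v} {k} t T₁ T₂ = (I : Subset t k) (u : Tuple v t) → count I u T₁ ≡ count I u T₂

-- Serves twice: it turns balance of a slice into balance of the unsliced pair, and it builds index
-- sets that pin down the head of a tuple.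
withZero : Subset t k → Subset (suc t) (suc k)
withZero I .index zero    = zero
withZero I .index (suc j) = suc (index I j)
withZero I .increasing {zero}  {suc j} _         = s≤s z≤n
withZero I .increasing {suc i} {suc j} (s≤s i<j) = s≤s (increasing I i<j)

-- As only one coordinate is left out, agreement on this set leaves only the head of a tuple free.
withoutZero : Subset t (suc t)
withoutZero .index      = suc
withoutZero .increasing = s≤s

lookup-injective : ∀ {x y : Tuple v k} → (∀ j → lookup x j ≡ lookup y j) → x ≡ y
lookup-injective {x = x} {y} x≗y =
  trans (sym (tabulate∘lookup x)) (trans (tabulate-cong x≗y) (tabulate∘lookup y))

slice : Fin v → List (Tuple v (suc k)) → List (Tuple v k)
slice a T = map tail (filter (λ x → head x ≟ a) T)

∈-slice⁺ : ∀ {a : Fin v} {xs : Tuple v k} {T} → a ∷ xs ∈ T → xs ∈ slice a T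
∈-slice⁺ {a = a} x∈T = ∈-map⁺ tail (∈-filter⁺ (λ x → head x ≟ a) x∈T refl)

∈-slice⁻ : ∀ {a : Fin v} {xs : Tuple v k} {T} → xs ∈ slice a T → a ∷ xs ∈ T
∈-slice⁻ {a = a} xs∈ with ∈-map⁻ tail xs∈
... | (_ ∷ _) , y∈ , refl with ∈-filter⁻ (λ x → head x ≟ a) y∈
...   | y∈T , refl = y∈T

count-slice : ∀ (I : Subset t k) u (a : Fin v) T →
              count I u (slice a T) ≡ count (withZero I) (a ∷ u) T
count-slice I u a [] = refl
count-slice I u a ((x ∷ xs) ∷ T) with x ≟ a
-- The test for `withZero I` computes to `x ≟ a` followed by the test for `I`, so splitting on these
-- two evaluates both counts at once.
... | no _ = count-slice I u a T
... | yes _ with does (contains? I u xs)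
...   | true  = cong suc (count-slice I u a T)
...   | false = count-slice I u a T

slice-balanced : ∀ {T₁ T₂ : List (Tuple v (suc k))} (a : Fin v) →
                 Balanced (suc t) T₁ T₂ → Balanced t (slice a T₁) (slice a T₂)
slice-balanced {T₁ = T₁} {T₂} a bal I u = begin
  count I u (slice a T₁)          ≡⟨ count-slice I u a T₁ ⟩
  count (withZero I) (a ∷ u) T₁   ≡⟨ bal (withZero I) (a ∷ u) ⟩
  count (withZero I) (a ∷ u) T₂   ≡⟨ count-slice I u a T₂ ⟨
  count I u (slice a T₂)          ∎
  where open ≡-Reasoning

slice-disjoint : ∀ {T₁ T₂ : List (Tuple v (suc k))} (a : Fin v) →
                 Disjoint T₁ T₂ → Disjoint (slice a T₁) (slice a T₂)
slice-disjoint a disj (x∈₁ , x∈₂) = disj (∈-slice⁻ x∈₁ , ∈-slice⁻ x∈₂)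

length-slices : ∀ {a b : Fin v} → a ≢ b → (T : List (Tuple v (suc k))) →
                length (slice a T) + length (slice b T) ≤ length T
length-slices a≢b [] = z≤n
length-slices {a = a} {b} a≢b ((x ∷ xs) ∷ T) with x ≟ a | x ≟ b
... | yes refl | yes refl = contradiction refl a≢b
... | yes _    | no _     = s≤s (length-slices a≢b T)
... | no _     | yes _    rewrite +-suc (length (slice a T)) (length (slice b T)) =
  s≤s (length-slices a≢b T)
... | no _     | no _     = m≤n⇒m≤1+n (length-slices a≢b T)

count-witness : ∀ (I : Subset t k) (u : Tuple v t) T →
                0 < count I u T → ∃ λ y → y ∈ T × Contains I u y
count-witness I u T 0<count with filter (contains? I u) T in eq
... | y ∷ _ = y , ∈-filter⁻ (contains? I u) (subst (y ∈_) (sym eq) (here refl))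

-- Take `u` to be the restriction of `x` to `I`: then `x` itself makes the count in `T₁` positive,
-- hence also the count in `T₂`.
agreeing : ∀ {T₁ T₂ : List (Tuple v k)} {x} → Balanced t T₁ T₂ → (I : Subset t k) → x ∈ T₁ →
           ∃ λ y → y ∈ T₂ × (∀ j → lookup y (index I j) ≡ lookup x (index I j))
agreeing {T₁ = T₁} {T₂} {x} bal I x∈T₁ = y , y∈T₂ , λ j → trans (c j) (lookup∘tabulate f j)
  where
  f = λ j → lookup x (index I j)
  u = tabulate f
  0<count : 0 < count I u T₁
  0<count = ∈-length (∈-filter⁺ (contains? I u) x∈T₁ (λ j → sym (lookup∘tabulate f j)))
  witness = count-witness I u T₂ (subst (0 <_) (bal I u) 0<count)
  y = proj₁ witness
  y∈T₂ = proj₁ (proj₂ witness)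
  c = proj₂ (proj₂ witness)

-- Induction on `t`. A member `x` stands for nonemptiness: it starts the search for a second head,
-- and each slice inherits such a member.
2^t≤length : ∀ t {T₁ T₂ : List (Tuple v (suc t))} {x} →
             Disjoint T₁ T₂ → Balanced t T₁ T₂ → x ∈ T₁ → 2 ^ t ≤ length T₁
2^t≤length zero disj bal x∈T₁ = ∈-length x∈T₁
2^t≤length (suc t) {T₁} {T₂} {a ∷ xs} disj bal x∈T₁
  with b ∷ ys , y∈T₂ , ys≗xs ← agreeing bal withoutZero x∈T₁
  -- Now from `T₂` back to `T₁`, on all coordinates except the second; the first is among them, so
  -- `c` equals `b`.
  with c ∷ zs , z∈T₁ , z≗y ← agreeing (λ I u → sym (bal I u)) (withZero withoutZero) y∈T₂
  with refl ← z≗y zero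
  = begin
  2 ^ t + (2 ^ t + 0)                       ≡⟨ cong (2 ^ t +_) (+-identityʳ (2 ^ t)) ⟩
  2 ^ t + 2 ^ t                             ≤⟨ +-mono-≤ (sliceBound x∈T₁) (sliceBound z∈T₁) ⟩
  length (slice a T₁) + length (slice b T₁) ≤⟨ length-slices a≢b T₁ ⟩
  length T₁                                 ∎
  where
  open ≤-Reasoning
  sliceBound : ∀ {d ws} → d ∷ ws ∈ T₁ → 2 ^ t ≤ length (slice d T₁)
  sliceBound {d} w∈T₁ =
    2^t≤length t (slice-disjoint d disj) (slice-balanced {T₁ = T₁} {T₂} d bal) (∈-slice⁺ w∈T₁)
  a≢b : a ≢ b
  -- With equal heads, `y` would be the tuple `x`, lying in both lists.
  a≢b refl = disj (x∈T₁ , subst (_∈ T₂) (cong (a ∷_) (lookup-injective ys≗xs)) y∈T₂)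

theorem2 : (t : ℕ) → 1 ≤ t → (s : ℕ) → 0 < s → s < 2 ^ t →
    (v : ℕ) → 1 ≤ v → ¬ LatinTrade t v (t + 1) s
-- `t + 1` does not reduce to `suc t`, the form that slicing requires.
theorem2 t _ s 0<s s<2^t v _ trade = main (subst (λ k → LatinTrade t v k s) (+-comm t 1) trade)
  where
  main : ¬ LatinTrade t v (suc t) s
  main record { T₁ = [] ; volume₁ = refl } = contradiction 0<s λ ()
  main record { T₁ = _ ∷ _ ; disjoint = disj ; volume₁ = refl ; balanced = bal } =
    <⇒≱ s<2^t (2^t≤length t disj bal (here refl))
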